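{- Let $n$ be a positive integer and let $a,b$ be distinct integers with $0<a,b<n$, so that $G=C_{2n}(a,b,n)$ is a $5$-regular circulant graph. If $3$ divides none of the integers $a$, $b$, $2n-a$, $2n-b$, $n$, then $G$ is word-representable.
   Context: Two distinct letters $x,y$ alternate in a word $w$ if, after deleting all other letters from $w$, the resulting word is of the form $xyxy\cdots$ or $yxyx\cdots$ (of even or odd length). A graph $G=(V,E)$ is word-representable if there is a word $w$ over the alphabet $V$, containing every letter of $V$ at least once, such that for all distinct $x,y\in V$, $xy\in E$ if and only if $x$ and $y$ alternate in $w$. For an integer $m$ and a set $R$ of positive integers each at most $m/2$, the circulant graph $C_m(R)$ has vertex set $\{0,1,\dots,m-1\}$, with $i$ and $j$ adjacent iff $\min(|i-j|,\,m-|i-j|)\in R$. $C_{2n}(a,b,n)$ denotes the circulant graph on $2n$ vertices with jump set $\{a,b,n\}$. -}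

module Defs where

open import Data.Nat using (ℕ; zero; suc; _<_; _≤_; _*_; _∸_; _⊓_; ∣_-_∣)
open import Data.Nat.Properties using (∣-∣-comm; ∣n-n∣≡0; <-irrefl; <⇒≤; ≤-refl; *-monoʳ-≤)
open import Data.Fin using (Fin; toℕ; _≟_)
open import Data.List using (List; []; _∷_; filter)
open import Data.List.Membership.Propositional using () renaming (_∈_ to _∈ˡ_)
open import Data.Product using (_×_; _,_; proj₁; ∃-syntax)
open import Data.Sum using (_⊎_; inj₁; inj₂)
open import Function.Bundles using (_⇔_)
open import Level using (0ℓ)
open import Relation.Binary.Core using (Rel)
open import Relation.Binary.Definitions using (Symmetric; Irreflexive)
open import Relation.Binary.PropositionalEquality using (_≡_; _≢_; refl; sym; cong; subst)
open import Relation.Nullary.Decidable using (_⊎-dec_)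
open import Relation.Unary using (Pred; _∈_; _∪_; ｛_｝)

record Graph (m : ℕ) : Set₁ where
  field
    Adj        : Rel (Fin m) 0ℓ
    adj-sym    : Symmetric Adj
    adj-irrefl : Irreflexive _≡_ Adj

Word : ℕ → Set
Word m = List (Fin m)

restrict : ∀ {m} → Fin m → Fin m → Word m → Word m
restrict x y = filter (λ z → (z ≟ x) ⊎-dec (z ≟ y))

-- The word x y x y ⋯ of length k.
alternating : ∀ {m} → Fin m → Fin m → ℕ → Word m
alternating x y zero    = []
alternating x y (suc k) = x ∷ alternating y x k

Alternate : ∀ {m} → Fin m → Fin m → Word m → Set
Alternate x y w =
  ∃[ k ] (restrict x y w ≡ alternating x y k ⊎ restrict x y w ≡ alternating y x k)

Represents : ∀ {m} → Word m → Graph m → Set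
Represents {m} w G =
  ((x : Fin m) → x ∈ˡ w) ×
  ((x y : Fin m) → x ≢ y → Graph.Adj G x y ⇔ Alternate x y w)

WordRepresentable : ∀ {m} → Graph m → Set
WordRepresentable {m} G = ∃[ w ] Represents {m} w G

circularDistance : ∀ {m} → Fin m → Fin m → ℕ
circularDistance {m} i j = ∣ toℕ i - toℕ j ∣ ⊓ (m ∸ ∣ toℕ i - toℕ j ∣)

IsJumpSet : ℕ → Pred ℕ 0ℓ → Set
IsJumpSet m R = ∀ r → r ∈ R → 0 < r × 2 * r ≤ m

circulant : (m : ℕ) (R : Pred ℕ 0ℓ) → IsJumpSet m R → Graph m
circulant m R jumps = record
  { Adj        = λ i j → circularDistance i j ∈ R
  ; adj-sym    = λ {i} {j} → subst (_∈ R)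
      (cong (λ d → d ⊓ (m ∸ d)) (∣-∣-comm (toℕ i) (toℕ j)))
  ; adj-irrefl = λ { {i} refl d∈R →
      <-irrefl (sym (cong (λ d → d ⊓ (m ∸ d)) (∣n-n∣≡0 (toℕ i))))
               (proj₁ (jumps _ d∈R)) }
  }

isJumpSet-abn : ∀ {n a b} → 0 < n → 0 < a → a < n → 0 < b → b < n →
                IsJumpSet (2 * n) (｛ a ｝ ∪ ｛ b ｝ ∪ ｛ n ｝)
isJumpSet-abn 0<n 0<a a<n 0<b b<n _ (inj₁ refl)        = 0<a , *-monoʳ-≤ 2 (<⇒≤ a<n)
isJumpSet-abn 0<n 0<a a<n 0<b b<n _ (inj₂ (inj₁ refl)) = 0<b , *-monoʳ-≤ 2 (<⇒≤ b<n)
isJumpSet-abn 0<n 0<a a<n 0<b b<n _ (inj₂ (inj₂ refl)) = 0<n , ≤-refl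

{-# OPTIONS --safe #-}

-- The hypotheses make i ↦ i mod 3 a proper colouring, and every properly
-- 3-coloured graph is word-representable. Write S₀, S₁, S₂ for the colour
-- classes. In S₀S₁S₂S₀S₁S₂ any two vertices of different colours alternate. For
-- a vertex x of colour i, move one occurrence of x to the right, past the rest of
-- Sᵢ and past the non-neighbours of x in the next class (cyclically) but before
-- its neighbours there. Edges still alternate as s t s t with the smaller colour
-- first, whereas x now fails to alternate with the passed vertices of the next class
-- and with those vertices of Sᵢ that are listed after x. The concatenation of these
-- blocks over all x represents the graph, because two non-adjacent vertices either
-- share their colour or one of them has the colour following that of the other.
module Submission where

open import Defs
open import Data.Bool using (Bool; true; false; T; not; _∧_; if_then_else_; T?)
open import Data.Fin using (Fin; toℕ; _≟_) renaming (_<_ to _<ᶠ_)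
open import Data.Fin.Patterns using (0F; 1F; 2F)
open import Data.Fin.Properties using (<-cmp; toℕ<n)
open import Data.List using (List; []; _∷_; _++_; [_]; concatMap; filter; filterᵇ; allFin; length)
open import Data.List.Membership.Propositional using () renaming (_∈_ to _∈ˡ_)
open import Data.List.Membership.Propositional.Properties
  using (∈-filter⁺; ∈-allFin; ∈-∃++; ∈-concatMap⁺)
open import Data.List.Properties
  using (filter-++; filter-≐; concatMap-++; concatMap-cong; ++-assoc;
         ++-identityʳ; ∷-injectiveʳ)
open import Data.List.Relation.Unary.All using (All; []; _∷_)
open import Data.List.Relation.Unary.All.Properties using (all-filter)
open import Data.List.Relation.Unary.AllPairs using (_∷_)
open import Data.List.Relation.Unary.Any as Any using (Any; here; there)
open import Data.List.Relation.Unary.Unique.Propositional using (Unique)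
import Data.List.Relation.Unary.Unique.Propositional.Properties as Unique
open import Data.Nat using (ℕ; suc; _+_; _<_; _≤_; _*_; _∸_; _⊓_; ∣_-_∣; s≤s)
import Data.Nat as ℕ
open import Data.Nat.Divisibility using (_∣_; divides)
open import Data.Nat.DivMod using (_div_; _mod_; DivMod; _divMod_)
open import Data.Nat.Properties
  using (⊓-sel; m∸[m∸n]≡n; m+n∸m≡n; +-identityʳ; <⇒≤; ≤-trans; ∣m-n∣≤m⊔n; ⊔-lub;
         *-distribʳ-∣-∣; ∣m+n-m+o∣≡∣n-o∣)
open import Data.Product using (_×_; _,_; proj₁; ∃-syntax)
open import Data.Sum using (_⊎_; inj₁; inj₂; swap)
open import Function using (_∘_)
open import Function.Bundles using (mk⇔)
open import Relation.Binary.Definitions using (Decidable; tri<; tri≈; tri>)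
open import Relation.Binary.PropositionalEquality
  using (_≡_; _≢_; refl; sym; trans; cong; cong₂; subst; module ≡-Reasoning)
open import Relation.Nullary using (¬_; Dec; does; yes; no; contradiction)
open import Relation.Nullary.Decidable using (_⊎-dec_; dec-true; dec-false; decidable-stable)
open import Relation.Unary using (_∈_; _∪_; ｛_｝) renaming (Decidable to Decidable₁)

-- Filters and duplicate-free lists.

-- Lets the restriction to two letters be taken before a segment is selected, so that only their
-- order in `allFin m` matters.
filter-comm : ∀ {A : Set} {P Q : A → Set} (P? : Decidable₁ P) (Q? : Decidable₁ Q) xs →
              filter P? (filter Q? xs) ≡ filter Q? (filter P? xs)
filter-comm P? Q? [] = refl
filter-comm P? Q? (x ∷ xs) with does (P? x) in p | does (Q? x) in q
... | true  | true  rewrite p | q = cong (x ∷_) (filter-comm P? Q? xs)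
... | true  | false rewrite q = filter-comm P? Q? xs
... | false | true  rewrite p = filter-comm P? Q? xs
... | false | false = filter-comm P? Q? xs

filterᵇ-pair : ∀ {A : Set} (p : A → Bool) x y →
               filterᵇ p (x ∷ y ∷ []) ≡ (if p x then [ x ] else []) ++ (if p y then [ y ] else [])
filterᵇ-pair p x y with p x
... | true  with p y
...   | true  = refl
...   | false = refl
filterᵇ-pair p x y | false with p y
...   | true  = refl
...   | false = refl

filter-concatMap : ∀ {A B : Set} {P : B → Set} (P? : Decidable₁ P) (f : A → List B) xs →
                   filter P? (concatMap f xs) ≡ concatMap (filter P? ∘ f) xs
filter-concatMap P? f [] = refl
filter-concatMap P? f (x ∷ xs) = trans (filter-++ P? (f x) (concatMap f xs))
  (cong (filter P? (f x) ++_) (filter-concatMap P? f xs))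

unique-pair : ∀ {A : Set} {x y : A} {zs} → x ≢ y → Unique zs →
              All (λ z → z ≡ x ⊎ z ≡ y) zs → x ∈ˡ zs → y ∈ˡ zs →
              zs ≡ x ∷ y ∷ [] ⊎ zs ≡ y ∷ x ∷ []
unique-pair x≢y _ (_ ∷ []) (here refl) (here refl) = contradiction refl x≢y
unique-pair _ ((z≢z ∷ _) ∷ _) (inj₁ refl ∷ inj₁ refl ∷ _) _ _ = contradiction refl z≢z
unique-pair _ ((z≢z ∷ _) ∷ _) (inj₂ refl ∷ inj₂ refl ∷ _) _ _ = contradiction refl z≢z
unique-pair _ _ (inj₁ refl ∷ inj₂ refl ∷ []) _ _ = inj₁ refl
unique-pair _ _ (inj₂ refl ∷ inj₁ refl ∷ []) _ _ = inj₂ refl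
unique-pair _ ((_ ∷ z≢z ∷ _) ∷ _) (inj₁ refl ∷ inj₂ refl ∷ inj₁ refl ∷ _) _ _ = contradiction refl z≢z
unique-pair _ (_ ∷ (z≢z ∷ _) ∷ _) (inj₁ refl ∷ inj₂ refl ∷ inj₂ refl ∷ _) _ _ = contradiction refl z≢z
unique-pair _ (_ ∷ (z≢z ∷ _) ∷ _) (inj₂ refl ∷ inj₁ refl ∷ inj₁ refl ∷ _) _ _ = contradiction refl z≢z
unique-pair _ ((_ ∷ z≢z ∷ _) ∷ _) (inj₂ refl ∷ inj₁ refl ∷ inj₂ refl ∷ _) _ _ = contradiction refl z≢z

-- Squares and alternation.

-- Only squares of a single letter are meant: a word in two letters fails to alternate exactly when
-- some letter is doubled.
HasSquare : ∀ {A : Set} → List A → Set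
HasSquare w = ∃[ u ] ∃[ z ] ∃[ v ] w ≡ u ++ z ∷ z ∷ v

HasSquare-++ : ∀ {A : Set} (p : List A) {w} q → HasSquare w → HasSquare (p ++ w ++ q)
HasSquare-++ p q (u , z , v , refl) = p ++ u , z , v ++ q ,
  trans (cong (p ++_) (++-assoc u (z ∷ z ∷ v) q)) (sym (++-assoc p u (z ∷ z ∷ v ++ q)))

alternating-squareFree : ∀ {m} {x y : Fin m} → x ≢ y → ∀ k → ¬ HasSquare (alternating x y k)
alternating-squareFree x≢y (suc (suc k)) ([] , _ , _ , refl) = x≢y refl
-- Dropping the first letter makes `x` and `y` trade places.
alternating-squareFree x≢y (suc k) (_ ∷ u , z , v , eq) =
  alternating-squareFree (x≢y ∘ sym) k (u , z , v , ∷-injectiveʳ eq)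

square⇒¬Alternate : ∀ {m} {x y : Fin m} {w} → x ≢ y →
                    HasSquare (restrict x y w) → ¬ Alternate x y w
square⇒¬Alternate x≢y sq (k , inj₁ eq) = alternating-squareFree x≢y k (subst HasSquare eq sq)
square⇒¬Alternate x≢y sq (k , inj₂ eq) =
  alternating-squareFree (x≢y ∘ sym) k (subst HasSquare eq sq)

restrict-comm : ∀ {m} (x y : Fin m) w → restrict x y w ≡ restrict y x w
restrict-comm x y = filter-≐ _ _ (swap , swap)

Alternate-sym : ∀ {m} {x y : Fin m} {w} → Alternate x y w → Alternate y x w
Alternate-sym {x = x} {y} {w} (k , alt) =
  k , swap (subst (λ v → v ≡ _ ⊎ v ≡ _) (restrict-comm x y w) alt)

restrict-allFin : ∀ {m} {x y : Fin m} → x ≢ y →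
                  restrict x y (allFin m) ≡ x ∷ y ∷ [] ⊎ restrict x y (allFin m) ≡ y ∷ x ∷ []
restrict-allFin {m} {x} {y} x≢y =
  unique-pair x≢y (Unique.filter⁺ xy? (Unique.allFin⁺ m)) (all-filter xy? (allFin m))
    (∈-filter⁺ xy? (∈-allFin x) (inj₁ refl)) (∈-filter⁺ xy? (∈-allFin y) (inj₂ refl))
  where
  xy? : ∀ z → Dec (z ≡ x ⊎ z ≡ y)
  xy? z = (z ≟ x) ⊎-dec (z ≟ y)

-- Blocks as seen by two letters.

-- Subsets of a colour class, relative to the vertex x whose block is being formed.
data Part : Set where
  everyone self others near far : Part

inPart : Part → (isSelf isNear : Bool) → Bool
inPart everyone e a = true
inPart self     e a = e
inPart others   e a = not e
inPart near     e a = a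
inPart far      e a = not a

-- The block of a vertex of the given colour: a pair (k , p) stands for the vertices of
-- colour k in p, listed in increasing order.
layout : Fin 3 → List (Fin 3 × Part)
layout 0F = (0F , everyone) ∷ (1F , everyone) ∷ (2F , everyone)
          ∷ (0F , others) ∷ (1F , far) ∷ (0F , self) ∷ (1F , near) ∷ (2F , everyone) ∷ []
layout 1F = (0F , everyone) ∷ (1F , everyone) ∷ (2F , everyone)
          ∷ (0F , everyone) ∷ (1F , others) ∷ (2F , far) ∷ (1F , self) ∷ (2F , near) ∷ []
layout 2F = (0F , everyone) ∷ (1F , everyone) ∷ (2F , others)
          ∷ (0F , far) ∷ (2F , self) ∷ (0F , near) ∷ (1F , everyone) ∷ (2F , everyone) ∷ []

-- The colour of a vertex, whether it is x, and whether it is adjacent to x.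
View : Set
View = Fin 3 × Bool × Bool

occurs : Fin 3 × Part → View → Bool
occurs (k , p) (c , e , a) = does (c ≟ k) ∧ inPart p e a

next : Fin 3 → Fin 3
next 0F = 1F
next 1F = 2F
next 2F = 0F

-- Three colours are essential here: in a longer cycle some classes would be neither equal nor
-- consecutive.
same-or-next : ∀ c d → c ≡ d ⊎ d ≡ next c ⊎ c ≡ next d
same-or-next 0F 0F = inj₁ refl
same-or-next 0F 1F = inj₂ (inj₁ refl)
same-or-next 0F 2F = inj₂ (inj₂ refl)
same-or-next 1F 0F = inj₂ (inj₂ refl)
same-or-next 1F 1F = inj₁ refl
same-or-next 1F 2F = inj₂ (inj₁ refl)
same-or-next 2F 0F = inj₂ (inj₁ refl)
same-or-next 2F 1F = inj₂ (inj₂ refl)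
same-or-next 2F 2F = inj₁ refl

next≢ : ∀ c → c ≢ next c
next≢ 0F ()
next≢ 1F ()
next≢ 2F ()

module _ {A : Set} where

  traceSegment : View → View → A → A → Fin 3 × Part → List A
  traceSegment σ τ s t seg =
    (if occurs seg σ then [ s ] else []) ++ (if occurs seg τ then [ t ] else [])

  -- A segment has a single colour, so here its internal order does not matter.
  traceSegment-comm : ∀ (σ τ : View) {s t : A} → proj₁ σ ≢ proj₁ τ →
    ∀ seg → traceSegment σ τ s t seg ≡ traceSegment τ σ t s seg
  traceSegment-comm (c , e , a) (d , f , b) c≢d (k , p) with c ≟ k | d ≟ k
  ... | yes refl | yes refl = contradiction refl c≢d
  ... | no _     | no _     = refl
  ... | no _     | yes _    = sym (++-identityʳ _)
  ... | yes _    | no _     = ++-identityʳ _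

  -- Models a block restricted to `s` and `t` when `s` is listed first. It sees the letters only
  -- through their views, so claims about blocks become finite case checks.
  trace : Fin 3 → View → View → A → A → List A
  trace i σ τ s t = concatMap (traceSegment σ τ s t) (layout i)

  -- The implications encode the edge: if one letter is the moved vertex, the other is its
  -- neighbour, hence in `near` when it has the next colour, and is not passed.
  trace-edge : ∀ i {c d} e f a b {s t : A} → c <ᶠ d →
               (e ≡ true → b ≡ true) → (f ≡ true → a ≡ true) →
               trace i (c , e , a) (d , f , b) s t ≡ s ∷ t ∷ s ∷ t ∷ []
  trace-edge 0F {0F} {1F} true  f a true  _ h _ = refl
  trace-edge 0F {0F} {1F} true  f a false _ h _ = contradiction (h refl) λ ()
  trace-edge 0F {0F} {1F} false f a true  _ _ _ = refl
  trace-edge 0F {0F} {1F} false f a false _ _ _ = refl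
  trace-edge 0F {0F} {2F} true  f a b     _ _ _ = refl
  trace-edge 0F {0F} {2F} false f a b     _ _ _ = refl
  trace-edge 0F {1F} {2F} e f true  b     _ _ _ = refl
  trace-edge 0F {1F} {2F} e f false b     _ _ _ = refl
  trace-edge 1F {0F} {1F} e true  a b     _ _ _ = refl
  trace-edge 1F {0F} {1F} e false a b     _ _ _ = refl
  trace-edge 1F {0F} {2F} e f a true      _ _ _ = refl
  trace-edge 1F {0F} {2F} e f a false     _ _ _ = refl
  trace-edge 1F {1F} {2F} true  f a true  _ _ _ = refl
  trace-edge 1F {1F} {2F} true  f a false _ h _ = contradiction (h refl) λ ()
  trace-edge 1F {1F} {2F} false f a true  _ _ _ = refl
  trace-edge 1F {1F} {2F} false f a false _ _ _ = refl
  trace-edge 2F {0F} {1F} e f true  b     _ _ _ = refl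
  trace-edge 2F {0F} {1F} e f false b     _ _ _ = refl
  trace-edge 2F {0F} {2F} e true  true  b _ _ _ = refl
  trace-edge 2F {0F} {2F} e true  false b _ _ h = contradiction (h refl) λ ()
  trace-edge 2F {0F} {2F} e false true  b _ _ _ = refl
  trace-edge 2F {0F} {2F} e false false b _ _ _ = refl
  trace-edge 2F {1F} {2F} e true  a b     _ _ _ = refl
  trace-edge 2F {1F} {2F} e false a b     _ _ _ = refl
  trace-edge _ {1F} {1F} _ _ _ _ (s≤s ())
  trace-edge _ {2F} {1F} _ _ _ _ (s≤s ())
  trace-edge _ {2F} {2F} _ _ _ _ (s≤s (s≤s ()))

  -- Having been moved past its class, `s` follows `t` in one copy of the class and precedes it in
  -- the other; the letter between the two copies is doubled.
  trace-sameColour : ∀ i a b {s t : A} → HasSquare (trace i (i , true , a) (i , false , b) s t)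
  trace-sameColour 0F a b {s} {t} = [ s ] , t , [ s ] , refl
  trace-sameColour 1F a b {s} {t} = [ s ] , t , [ s ] , refl
  -- For colour 2 the first occurrence moves, into the second copy of class 0, so here the order is
  -- reversed in the first copy.
  trace-sameColour 2F a b {s} {t} = [ t ] , s , [ t ] , refl

  -- The non-neighbour `t` lies in `far`, so the moved `s` passes it and no `s` separates the two
  -- occurrences of `t`.
  trace-nextColour : ∀ i a f {s t : A} → HasSquare (trace i (i , true , a) (next i , f , false) s t)
  trace-nextColour 0F a f {s} {t} = [ s ] , t , [ s ] , refl
  trace-nextColour 1F a f {s} {t} = [ s ] , t , [ s ] , refl
  trace-nextColour 2F a f {s} {t} = [] , t , s ∷ [ s ] , refl

-- The word of a properly 3-coloured graph.

module _ {m} (G : Graph m) (Adj? : Decidable (Graph.Adj G)) (colour : Fin m → Fin 3)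
         (proper : ∀ {x y} → Graph.Adj G x y → colour x ≢ colour y) where

  open Graph G

  view : Fin m → Fin m → View
  view x v = colour v , does (v ≟ x) , does (Adj? x v)

  segment : Fin m → Fin 3 × Part → Word m
  segment x seg = filterᵇ (occurs seg ∘ view x) (allFin m)

  block : Fin m → Word m
  block x = concatMap (segment x) (layout (colour x))

  word : Word m
  word = concatMap block (allFin m)

  module _ (x : Fin m) {s t : Fin m} where

    restrict-segment-ordered : restrict s t (allFin m) ≡ s ∷ t ∷ [] →
      ∀ seg → restrict s t (segment x seg) ≡ traceSegment (view x s) (view x t) s t seg
    restrict-segment-ordered order seg = begin
      restrict s t (segment x seg)               ≡⟨ filter-comm _ (T? ∘ chosen) (allFin m) ⟩
      filterᵇ chosen (restrict s t (allFin m))   ≡⟨ cong (filterᵇ chosen) order ⟩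
      filterᵇ chosen (s ∷ t ∷ [])                ≡⟨ filterᵇ-pair chosen s t ⟩
      traceSegment (view x s) (view x t) s t seg ∎
      where
      open ≡-Reasoning
      chosen : Fin m → Bool
      chosen = occurs seg ∘ view x

    restrict-block-ordered : restrict s t (allFin m) ≡ s ∷ t ∷ [] →
      restrict s t (block x) ≡ trace (colour x) (view x s) (view x t) s t
    restrict-block-ordered order = trans
      (filter-concatMap _ (segment x) (layout (colour x)))
      (concatMap-cong (restrict-segment-ordered order) (layout (colour x)))

  -- With different colours no segment contains both letters, so their order in `allFin m` is
  -- immaterial.
  restrict-block : ∀ x {s t} → colour s ≢ colour t →
    restrict s t (block x) ≡ trace (colour x) (view x s) (view x t) s t
  restrict-block x {s} {t} s≢t with restrict-allFin (s≢t ∘ cong colour)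
  ... | inj₁ order = restrict-block-ordered x order
  ... | inj₂ order = begin
    restrict s t (block x)
      ≡⟨ restrict-comm s t (block x) ⟩
    restrict t s (block x)
      ≡⟨ restrict-block-ordered x (trans (restrict-comm t s (allFin m)) order) ⟩
    trace (colour x) (view x t) (view x s) t s
      ≡⟨ concatMap-cong (traceSegment-comm _ _ (s≢t ∘ sym)) (layout (colour x)) ⟩
    trace (colour x) (view x s) (view x t) s t
      ∎
    where open ≡-Reasoning

  restrict-block-edge : ∀ {s t} → Adj s t → colour s <ᶠ colour t →
    ∀ x → restrict s t (block x) ≡ s ∷ t ∷ s ∷ t ∷ []
  restrict-block-edge {s} {t} st lt x = trans (restrict-block x (proper st))
    (trace-edge (colour x) _ _ _ _ lt s-near t-near)
    where
    -- If the vertex of the block is an end of the edge, the other end is its neighbour.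
    s-near : does (s ≟ x) ≡ true → does (Adj? x t) ≡ true
    s-near _ with s ≟ x
    s-near _  | yes refl = dec-true (Adj? s t) st
    s-near () | no _
    t-near : does (t ≟ x) ≡ true → does (Adj? x s) ≡ true
    t-near _ with t ≟ x
    t-near _  | yes refl = dec-true (Adj? t s) (adj-sym st)
    t-near () | no _

  edge⇒Alternate : ∀ {s t} → Adj s t → colour s <ᶠ colour t → Alternate s t word
  -- Each block contributes four letters. With 4 as the right factor, the length unfolds by four for
  -- each block.
  edge⇒Alternate {s} {t} st lt = length (allFin m) * 4 , inj₁ (trans
    (filter-concatMap _ block (allFin m))
    (blocks (allFin m)))
    where
    blocks : ∀ xs → concatMap (restrict s t ∘ block) xs ≡ alternating s t (length xs * 4)
    blocks [] = refl
    blocks (x ∷ xs) = cong₂ _++_ (restrict-block-edge st lt x) (blocks xs)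

  Adj⇒Alternate : ∀ {s t} → Adj s t → Alternate s t word
  Adj⇒Alternate {s} {t} st with <-cmp (colour s) (colour t)
  ... | tri< lt _ _ = edge⇒Alternate st lt
  ... | tri≈ _ eq _ = contradiction eq (proper st)
  ... | tri> _ _ gt = Alternate-sym {w = word} (edge⇒Alternate (adj-sym st) gt)

  -- A doubled letter survives concatenation, so a single block can destroy alternation.
  square-block⇒¬Alternate : ∀ x {s t} → s ≢ t →
    HasSquare (restrict s t (block x)) → ¬ Alternate s t word
  square-block⇒¬Alternate x {s} {t} s≢t sq with ∈-∃++ (∈-allFin x)
  ... | p , q , eq = square⇒¬Alternate {w = word} s≢t
    (subst HasSquare (sym split) (HasSquare-++ (restricted p) (restricted q) sq))
    where
    restricted : List (Fin m) → Word m
    restricted = concatMap (restrict s t ∘ block)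
    split : restrict s t word ≡ restricted p ++ restrict s t (block x) ++ restricted q
    split = trans (filter-concatMap _ block (allFin m))
      (trans (cong restricted eq) (concatMap-++ (restrict s t ∘ block) p (x ∷ q)))

  sameColour-ordered : ∀ {x y} → x ≢ y → colour x ≡ colour y →
    restrict x y (allFin m) ≡ x ∷ y ∷ [] → ¬ Alternate x y word
  sameColour-ordered {x} {y} x≢y same order = square-block⇒¬Alternate x x≢y
    (subst HasSquare (sym (restrict-block-ordered x order)) square)
    where
    square : HasSquare (trace (colour x) (view x x) (view x y) x y)
    square rewrite sym same | dec-true (x ≟ x) refl | dec-false (y ≟ x) (x≢y ∘ sym) =
      trace-sameColour (colour x) _ _

  sameColour⇒¬Alternate : ∀ {x y} → x ≢ y → colour x ≡ colour y → ¬ Alternate x y word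
  sameColour⇒¬Alternate {x} {y} x≢y same with restrict-allFin x≢y
  ... | inj₁ order = sameColour-ordered x≢y same order
  -- When `y` is listed first, its block provides the square.
  ... | inj₂ order = sameColour-ordered (x≢y ∘ sym) (sym same)
    (trans (restrict-comm y x (allFin m)) order)
    ∘ Alternate-sym {w = word}

  nextColour⇒¬Alternate : ∀ {x y} → ¬ Adj x y → colour y ≡ next (colour x) →
    ¬ Alternate x y word
  nextColour⇒¬Alternate {x} {y} ¬xy eq = square-block⇒¬Alternate x (x≢y ∘ cong colour)
    (subst HasSquare (sym (restrict-block x x≢y)) square)
    where
    x≢y : colour x ≢ colour y
    x≢y = next≢ (colour x) ∘ λ p → trans p eq
    square : HasSquare (trace (colour x) (view x x) (view x y) x y)
    square rewrite eq | dec-true (x ≟ x) refl | dec-false (Adj? x y) ¬xy =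
      trace-nextColour (colour x) _ _

  ¬Adj⇒¬Alternate : ∀ {x y} → x ≢ y → ¬ Adj x y → ¬ Alternate x y word
  ¬Adj⇒¬Alternate {x} {y} x≢y ¬xy with same-or-next (colour x) (colour y)
  ... | inj₁ same        = sameColour⇒¬Alternate x≢y same
  ... | inj₂ (inj₁ succ) = nextColour⇒¬Alternate ¬xy succ
  ... | inj₂ (inj₂ pred) =
    nextColour⇒¬Alternate (¬xy ∘ adj-sym) pred ∘ Alternate-sym {w = word}

  ∈-block : ∀ x → x ∈ˡ block x
  ∈-block x = ∈-concatMap⁺ (segment x) (Any.map selected (home (colour x)))
    where
    -- The position of the `self` segment in each layout; `x` is found there.
    home : ∀ c → Any (_≡ (c , self)) (layout c)
    home 0F = there (there (there (there (there (here refl)))))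
    home 1F = there (there (there (there (there (there (here refl))))))
    home 2F = there (there (there (there (here refl))))
    selected : ∀ {seg} → seg ≡ (colour x , self) → x ∈ˡ segment x seg
    selected refl = ∈-filter⁺ (T? ∘ occurs (colour x , self) ∘ view x) (∈-allFin x)
      (subst T (sym (cong₂ _∧_ (dec-true (colour x ≟ colour x) refl) (dec-true (x ≟ x) refl))) _)

  3-colourable⇒wordRepresentable : WordRepresentable G
  3-colourable⇒wordRepresentable = word
    , (λ x → ∈-concatMap⁺ block (Any.map (λ { refl → ∈-block x }) (∈-allFin x)))
    , λ x y x≢y → mk⇔ Adj⇒Alternate
        (λ alt → decidable-stable (Adj? x y) (λ ¬xy → ¬Adj⇒¬Alternate x≢y ¬xy alt))

-- Residues and circular distance.

mod-≡⇒∣ : ∀ d .{{_ : ℕ.NonZero d}} i j → i mod d ≡ j mod d → d ∣ ∣ i - j ∣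
mod-≡⇒∣ d i j eq = divides ∣ i div d - j div d ∣ (begin
  ∣ i - j ∣
    ≡⟨ cong₂ ∣_-_∣ (property (i divMod d)) (property (j divMod d)) ⟩
  ∣ toℕ (i mod d) + i div d * d - toℕ (j mod d) + j div d * d ∣
    ≡⟨ cong (λ r → ∣ toℕ (i mod d) + i div d * d - toℕ r + j div d * d ∣) eq ⟨
  ∣ toℕ (i mod d) + i div d * d - toℕ (i mod d) + j div d * d ∣
    ≡⟨ ∣m+n-m+o∣≡∣n-o∣ (toℕ (i mod d)) _ _ ⟩
  ∣ i div d * d - j div d * d ∣
    ≡⟨ *-distribʳ-∣-∣ d (i div d) (j div d) ⟨
  ∣ i div d - j div d ∣ * d ∎)
  where open ≡-Reasoning; open DivMod

-- Complementation `m ∸_` is an involution below `m`; hence both a jump and its complement must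
-- avoid multiples of 3.
⊓∸-cases : ∀ {m d} r → d ≤ m → r ≡ d ⊓ (m ∸ d) → d ≡ r ⊎ d ≡ m ∸ r
⊓∸-cases {m} {d} r d≤m eq with ⊓-sel d (m ∸ d)
... | inj₁ sel = inj₁ (sym (trans eq sel))
... | inj₂ sel = inj₂ (trans (sym (m∸[m∸n]≡n d≤m)) (cong (m ∸_) (sym (trans eq sel))))

theorem20 : (n a b : ℕ) (0<n : 0 < n) →
    a ≢ b →
    (0<a : 0 < a) (a<n : a < n) (0<b : 0 < b) (b<n : b < n) →
    ¬ (3 ∣ a) → ¬ (3 ∣ b) → ¬ (3 ∣ 2 * n ∸ a) → ¬ (3 ∣ 2 * n ∸ b) → ¬ (3 ∣ n) →
    WordRepresentable
    (circulant (2 * n) (｛ a ｝ ∪ ｛ b ｝ ∪ ｛ n ｝)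
    (isJumpSet-abn 0<n 0<a a<n 0<b b<n))
theorem20 n a b 0<n a≢b 0<a a<n 0<b b<n 3∤a 3∤b 3∤2n∸a 3∤2n∸b 3∤n =
  3-colourable⇒wordRepresentable
    (circulant (2 * n) (｛ a ｝ ∪ ｛ b ｝ ∪ ｛ n ｝) (isJumpSet-abn 0<n 0<a a<n 0<b b<n))
    (λ i j → let d = circularDistance i j in (a ℕ.≟ d) ⊎-dec (b ℕ.≟ d) ⊎-dec (n ℕ.≟ d))
    (λ i → toℕ i mod 3) (λ {i} {j} → proper {i} {j})
  where
  3∤2n∸n : ¬ (3 ∣ 2 * n ∸ n)
  -- The jump `n` is its own complement; `2 * n` unfolds to `n + (n + 0)`.
  3∤2n∸n = 3∤n ∘ subst (3 ∣_) (trans (m+n∸m≡n n (n + 0)) (+-identityʳ n))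

  -- Equal colours would make 3 divide the plain difference, which is `r` or `2 * n ∸ r`.
  avoid : ∀ {i j : Fin (2 * n)} r → ¬ (3 ∣ r) → ¬ (3 ∣ 2 * n ∸ r) →
          r ≡ circularDistance i j → toℕ i mod 3 ≢ toℕ j mod 3
  avoid {i} {j} r 3∤r 3∤2n∸r eq same
    with ⊓∸-cases r (≤-trans (∣m-n∣≤m⊔n (toℕ i) (toℕ j)) (⊔-lub (<⇒≤ (toℕ<n i)) (<⇒≤ (toℕ<n j)))) eq
  ... | inj₁ d≡r    = 3∤r (subst (3 ∣_) d≡r (mod-≡⇒∣ 3 (toℕ i) (toℕ j) same))
  ... | inj₂ d≡2n∸r = 3∤2n∸r (subst (3 ∣_) d≡2n∸r (mod-≡⇒∣ 3 (toℕ i) (toℕ j) same))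

  proper : ∀ {i j : Fin (2 * n)} → circularDistance i j ∈ ｛ a ｝ ∪ ｛ b ｝ ∪ ｛ n ｝ →
           toℕ i mod 3 ≢ toℕ j mod 3
  proper {i} {j} (inj₁ eq)        = avoid {i} {j} a 3∤a 3∤2n∸a eq
  proper {i} {j} (inj₂ (inj₁ eq)) = avoid {i} {j} b 3∤b 3∤2n∸b eq
  proper {i} {j} (inj₂ (inj₂ eq)) = avoid {i} {j} n 3∤n 3∤2n∸n eq
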